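{- There is an absolute constant $C$ such that for all positive integers $n$, $F_2(n)\ge \frac{n}{4}-C$. Consequently, $F^{\mathrm{weak}}(n)\ge \frac n4 - C$ for all $n$.
   Context: For a positive integer $n$, $[n]=\{1,\dots,n\}$ and $[n]^{(2)}$ is the set of $2$-element subsets of $[n]$. $\mathcal{C}_{n;r}$ is the set of all maps $c:[n]^{(2)}\to[r]$. For such $c$, a twin of size $\ell$ is a pair of disjoint sets $I=\{i_1<\dots<i_\ell\}$, $J=\{j_1<\dots<j_\ell\}\subset[n]$ with $c(\{i_t,i_{t+1}\})=c(\{j_t,j_{t+1}\})$ for all $t=1,\dots,\ell-1$; $f(c)$ is the maximum size of a twin of $c$, and $F_r(n)=\min_{c\in\mathcal{C}_{n;r}}f(c)$. For $\pi\in S_n$, a weak-twin of $\pi$ is a pair of disjoint sets $I=\{i_1<\dots<i_\ell\}$, $J=\{j_1<\dots<j_\ell\}\subset[n]$ such that for each $t\in[\ell-1]$, $\pi(i_t)<\pi(i_{t+1})$ if and only if $\pi(j_t)<\pi(j_{t+1})$; $f^{\mathrm{weak}}(\pi)$ is the largest $\ell$ such that $\pi$ has a weak-twin with $|I|=\ell$, and $F^{\mathrm{weak}}(n)=\min_{\pi\in S_n}f^{\mathrm{weak}}(\pi)$. -}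

module Defs where

open import Data.Nat using (ℕ; suc; _≤_; _+_; _*_)
open import Data.Fin using (Fin; toℕ) renaming (_<_ to _<ᶠ_)
open import Data.Fin.Permutation using (Permutation′; _⟨$⟩ʳ_)
open import Data.Product using (Σ; _×_)
open import Relation.Binary.PropositionalEquality using (_≡_; _≢_)
open import Relation.Nullary using (¬_)
open import Function.Bundles using (_⇔_)

-- Vertices [n] are represented by Fin n (0-indexed; order preserved).
-- An r-colouring of [n]^(2): c i j (for i < j) is the colour of the pair {i,j}.
-- Values c i j with i ≥ j are never read, so quantifying over all such
-- functions is the same as quantifying over all maps [n]^(2) → [r].
Coloring : ℕ → ℕ → Set
Coloring n r = Fin n → Fin n → Fin r

StrictInc : ∀ {n ℓ} → (Fin ℓ → Fin n) → Set
StrictInc {n} {ℓ} x = ∀ (s t : Fin ℓ) → s <ᶠ t → x s <ᶠ x t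

Disjoint : ∀ {n ℓ} → (Fin ℓ → Fin n) → (Fin ℓ → Fin n) → Set
Disjoint {n} {ℓ} x y = ∀ (s t : Fin ℓ) → x s ≢ y t

record Twin {n r : ℕ} (c : Coloring n r) (ℓ : ℕ) : Set where
  field
    I J     : Fin ℓ → Fin n
    I-inc   : StrictInc I
    J-inc   : StrictInc J
    disj    : Disjoint I J
    colours : ∀ (s t : Fin ℓ) → toℕ t ≡ suc (toℕ s) →
              c (I s) (I t) ≡ c (J s) (J t)

record WeakTwin {n : ℕ} (π : Permutation′ n) (ℓ : ℕ) : Set where
  field
    I J     : Fin ℓ → Fin n
    I-inc   : StrictInc I
    J-inc   : StrictInc J
    disj    : Disjoint I J
    updown  : ∀ (s t : Fin ℓ) → toℕ t ≡ suc (toℕ s) →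
              ((π ⟨$⟩ʳ I s) <ᶠ (π ⟨$⟩ʳ I t)) ⇔ ((π ⟨$⟩ʳ J s) <ᶠ (π ⟨$⟩ʳ J t))

-- "F_2(n) ≥ n/4 − C" : min over 2-colourings c of f(c) (the max twin size)
-- is ≥ n/4 − C, i.e. every colouring has a twin of size ℓ with 4ℓ + 4C ≥ n.
F₂-bound : ℕ → ℕ → Set
F₂-bound C n = (c : Coloring n 2) → Σ ℕ (λ ℓ → Twin c ℓ × n ≤ 4 * ℓ + 4 * C)

Fweak-bound : ℕ → ℕ → Set
Fweak-bound C n = (π : Permutation′ n) → Σ ℕ (λ ℓ → WeakTwin π ℓ × n ≤ 4 * ℓ + 4 * C)

{-# OPTIONS --safe #-}
-- Grow a twin from left to right, remembering at each stage three vertices any two of which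
-- can serve as the two last vertices of a twin of the current size ℓ.  Say that all three are
-- at most m and that only the third may equal m.  Among the five vertices m, …, m + 4 there is
-- again such a triple, for size ℓ + 1: this is a finite statement about the 14 colours of the
-- edges from the old triple to these vertices.  At most the last vertex of the new triple equals m + 4, so
-- each stage costs four vertices.
module Submission where

open import Defs
open import Data.Bool using (if_then_else_)
open import Data.Fin using (Fin; zero; suc; toℕ; opposite) renaming (_<_ to _<ᶠ_)
open import Data.Fin.Permutation using (Permutation′; _⟨$⟩ʳ_)
import Data.Fin.Properties as Finₚ
open import Data.Nat using (ℕ; zero; suc; _+_; _*_; _∸_; _≤_; _<_; z≤n; s≤s; z<s; s<s; s≤s⁻¹; NonZero)
open import Data.Nat.DivMod using (_/_; _%_; _mod_; m%n<n; m<n⇒m%n≡m; m≡m%n+[m/n]*n; m/n*n≤m)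
open import Data.Nat.Properties
open import Data.Product using (Σ; ∃; _×_; _,_; proj₁; proj₂)
open import Data.Sum using (_⊎_; inj₁; inj₂)
open import Data.Vec using (Vec; []; _∷_; lookup; tabulate; tail)
open import Data.Vec.Properties using (lookup∘tabulate)
open import Function using (_∘_)
open import Function.Bundles using (mk⇔)
open import Relation.Binary.PropositionalEquality
  using (_≡_; _≢_; sym; trans; cong; subst; subst₂; ≢-sym; module ≡-Reasoning)
open import Relation.Nullary using (Dec; yes; no; does; contradiction)
open import Relation.Nullary.Decidable using (map′; toWitness; _×-dec_; _⊎-dec_)
open import Relation.Unary using (Decidable)

-- The two sides of a twin are interchangeable, so the old last vertices behind `u` and `v` may be
-- continued to `x` and `y` in either assignment.
Match : ∀ {k} → (u v : Vec (Fin 2) k) → Fin k → Fin k → Set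
Match u v x y = lookup u x ≡ lookup v y ⊎ lookup u y ≡ lookup v x

match? : ∀ {k} (u v : Vec (Fin 2) k) x y → Dec (Match u v x y)
match? u v x y =
  (lookup u x Finₚ.≟ lookup v y) ⊎-dec (lookup u y Finₚ.≟ lookup v x)

-- u, v, w list the colours from the three remembered vertices; the third one may coincide
-- with the first of the new vertices, so w starts one vertex later than u and v.
Linked : ∀ {k} → (u v : Vec (Fin 2) (suc k)) → Vec (Fin 2) k → Fin (suc k) → Fin (suc k) → Set
Linked u v w (suc x) (suc y) =
  Match u v (suc x) (suc y) ⊎ Match (tail u) w x y ⊎ Match (tail v) w x y
Linked u v w x y = Match u v x y

linked? : ∀ {k} (u v : Vec (Fin 2) (suc k)) (w : Vec (Fin 2) k) x y → Dec (Linked u v w x y)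
linked? u v w zero    y       = match? u v zero y
linked? u v w (suc x) zero    = match? u v (suc x) zero
linked? u v w (suc x) (suc y) =
  match? u v (suc x) (suc y) ⊎-dec match? (tail u) w x y ⊎-dec match? (tail v) w x y

-- The order leaves only `z` free to be the last new vertex, which is what the next stage allows of
-- its third vertex.
LinkedTriple : ∀ {k} → (u v : Vec (Fin 2) (suc k)) → Vec (Fin 2) k → Set
LinkedTriple u v w =
  ∃ λ x → ∃ λ y → (x <ᶠ y × Linked u v w x y) ×
  ∃ λ z → y <ᶠ z × Linked u v w x z × Linked u v w y z

linkedTriple? : ∀ {k} (u v : Vec (Fin 2) (suc k)) w → Dec (LinkedTriple u v w)
linkedTriple? u v w =
  -- Testing `x` and `y` before the search for `z` discards failing pairs early in the exhaustive
  -- check.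
  Finₚ.any? λ x → Finₚ.any? λ y → (x Finₚ.<? y ×-dec linked? u v w x y) ×-dec
  Finₚ.any? λ z → y Finₚ.<? z ×-dec linked? u v w x z ×-dec linked? u v w y z

allVec? : ∀ {k} {P : Vec (Fin 2) k → Set} → Decidable P → Dec (∀ v → P v)
allVec? {zero}  P? = map′ (λ { p [] → p }) (λ f → f []) (P? [])
allVec? {suc k} P? =
  map′ (λ { f (x ∷ v) → f x v }) (λ f x v → f (x ∷ v))
    (Finₚ.all? λ x → allVec? λ v → P? (x ∷ v))

-- Unfolding this would rerun the exhaustive check inside later proofs.
abstract
  linkedTriple : (u v : Vec (Fin 2) 5) (w : Vec (Fin 2) 4) → LinkedTriple u v w
  linkedTriple = toWitness {a? = allVec? λ u → allVec? λ v → allVec? λ w → linkedTriple? u v w} _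

-- Chain c ℓ x y is a twin of size ℓ + 1 whose two last vertices are x and y.
data Chain (c : ℕ → ℕ → Fin 2) : ℕ → ℕ → ℕ → Set where
  start : ∀ {x y} → x ≢ y → Chain c 0 x y
  step  : ∀ {ℓ i j x y} → Chain c ℓ i j → i < x → i < y → j < x → j < y →
          x ≢ y → c i x ≡ c j y → Chain c (suc ℓ) x y

module _ {c : ℕ → ℕ → Fin 2} where

  swap : ∀ {ℓ x y} → Chain c ℓ x y → Chain c ℓ y x
  swap (start x≢y) = start (≢-sym x≢y)
  swap (step ch i<x i<y j<x j<y x≢y eq) = step (swap ch) j<y j<x i<y i<x (≢-sym x≢y) (sym eq)

  ends-≢ : ∀ {ℓ x y} → Chain c ℓ x y → x ≢ y
  ends-≢ (start x≢y)            = x≢y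
  ends-≢ (step _ _ _ _ _ x≢y _) = x≢y

  -- Index zero is the last vertex.
  left : ∀ {ℓ x y} → Chain c ℓ x y → Fin (suc ℓ) → ℕ
  left {x = x} _             zero    = x
  left (step ch _ _ _ _ _ _) (suc t) = left ch t

  -- Going through `swap` makes every fact about `left` available for the other side.
  right : ∀ {ℓ x y} → Chain c ℓ x y → Fin (suc ℓ) → ℕ
  right = left ∘ swap

  left-suc< : ∀ {ℓ x y} (ch : Chain c ℓ x y) (t : Fin ℓ) → left ch (suc t) < x × left ch (suc t) < y
  left-suc< (step _  i<x i<y _ _ _ _) zero    = i<x , i<y
  left-suc< (step ch i<x i<y _ _ _ _) (suc t) =
    let l<i = proj₁ (left-suc< ch t) in <-trans l<i i<x , <-trans l<i i<y

  left≤ : ∀ {ℓ x y} (ch : Chain c ℓ x y) t → left ch t ≤ x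
  left≤ ch zero    = ≤-refl
  left≤ ch (suc t) = <⇒≤ (proj₁ (left-suc< ch t))

  left-decreasing : ∀ {ℓ x y} (ch : Chain c ℓ x y) {s t} → s <ᶠ t → left ch t < left ch s
  left-decreasing ch                    {zero}  {suc t} _         = proj₁ (left-suc< ch t)
  left-decreasing (step ch _ _ _ _ _ _) {suc s} {suc t} (s<s s<t) = left-decreasing ch s<t

  -- Each end exceeds all earlier vertices of both sides, the two ends differ, and two earlier
  -- vertices already lie in the shorter chain.
  left≢right : ∀ {ℓ x y} (ch : Chain c ℓ x y) s t → left ch s ≢ right ch t
  left≢right ch                    zero    zero    = ends-≢ ch
  left≢right ch                    zero    (suc t) = >⇒≢ (proj₂ (left-suc< (swap ch) t))
  left≢right ch                    (suc s) zero    = <⇒≢ (proj₂ (left-suc< ch s))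
  left≢right (step ch _ _ _ _ _ _) (suc s) (suc t) = left≢right ch s t

  same-colours : ∀ {ℓ x y} (ch : Chain c ℓ x y) s t → toℕ s ≡ suc (toℕ t) →
                 c (left ch s) (left ch t) ≡ c (right ch s) (right ch t)
  same-colours (step _ _ _ _ _ _ eq) (suc zero) zero    _     = eq
  same-colours (step ch _ _ _ _ _ _) (suc s)    (suc t) s≡1+t =
    same-colours ch s t (suc-injective s≡1+t)

  -- The enumeration `p` of new vertices is left general: pairs containing the third remembered
  -- vertex use `p ∘ suc`.
  extend : ∀ {ℓ k a b x y} (p : Fin k → ℕ) → (∀ i → a < p i) → (∀ i → b < p i) →
           Chain c ℓ a b → p x ≢ p y →
           Match (tabulate (c a ∘ p)) (tabulate (c b ∘ p)) x y → Chain c (suc ℓ) (p x) (p y)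
  extend {a = a} {b} {x} {y} p a<p b<p ch px≢py (inj₁ eq) =
    step ch (a<p x) (a<p y) (b<p x) (b<p y) px≢py
      (subst₂ _≡_ (lookup∘tabulate (c a ∘ p) x) (lookup∘tabulate (c b ∘ p) y) eq)
  extend {a = a} {b} {x} {y} p a<p b<p ch px≢py (inj₂ eq) =
    swap (step ch (a<p y) (a<p x) (b<p y) (b<p x) (≢-sym px≢py)
      (subst₂ _≡_ (lookup∘tabulate (c a ∘ p) y) (lookup∘tabulate (c b ∘ p) x) eq))

record Triple (c : ℕ → ℕ → Fin 2) (ℓ m : ℕ) : Set where
  field
    {a b e} : ℕ
    a<m : a < m
    b<m : b < m
    e≤m : e ≤ m
    ab  : Chain c ℓ a b
    ae  : Chain c ℓ a e
    be  : Chain c ℓ b e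

module _ {c : ℕ → ℕ → Fin 2} where

  next : ∀ {ℓ m} → Triple c ℓ m → Triple c (suc ℓ) (m + 4)
  next {ℓ} {m} T =
    let x , y , (x<y , xy) , z , y<z , xz , yz =
          linkedTriple (tabulate (c a ∘ p)) (tabulate (c b ∘ p)) (tabulate (c e ∘ p ∘ suc))
    in record
      { a<m = +-monoʳ-< m (<-≤-trans x<y (≤4 y))
      ; b<m = +-monoʳ-< m (<-≤-trans y<z (≤4 z))
      ; e≤m = +-monoʳ-≤ m (≤4 z)
      ; ab  = link x y x<y xy
      ; ae  = link x z (<-trans x<y y<z) xz
      ; be  = link y z y<z yz
      }
    where
    open Triple T

    p : Fin 5 → ℕ
    p x = m + toℕ x

    ≤4 : (x : Fin 5) → toℕ x ≤ 4
    ≤4 = Finₚ.toℕ≤pred[n]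

    a<p : ∀ x → a < p x
    a<p x = <-≤-trans a<m (m≤m+n m _)

    b<p : ∀ x → b < p x
    b<p x = <-≤-trans b<m (m≤m+n m _)

    -- As `e` may equal `m`, only the vertices from `m + 1` on are certain to lie beyond it.
    e<p : ∀ x → e < p (suc x)
    e<p x = ≤-<-trans e≤m (m<m+n m z<s)

    link : ∀ x y → x <ᶠ y →
           Linked (tabulate (c a ∘ p)) (tabulate (c b ∘ p)) (tabulate (c e ∘ p ∘ suc)) x y →
           Chain c (suc ℓ) (p x) (p y)
    link zero (suc y) x<y h = extend p a<p b<p ab (<⇒≢ (+-monoʳ-< m x<y)) h
    link (suc x) (suc y) x<y (inj₁ h) =
      extend p a<p b<p ab (<⇒≢ (+-monoʳ-< m x<y)) h
    link (suc x) (suc y) x<y (inj₂ (inj₁ h)) =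
      extend (p ∘ suc) (a<p ∘ suc) e<p ae (<⇒≢ (+-monoʳ-< m x<y)) h
    link (suc x) (suc y) x<y (inj₂ (inj₂ h)) =
      extend (p ∘ suc) (b<p ∘ suc) e<p be (<⇒≢ (+-monoʳ-< m x<y)) h

  triple : ∀ k → Triple c k (2 + k * 4)
  -- Any two distinct vertices form a twin of size 1; of 0, 1, 2 only the third equals the bound 2.
  triple zero = record
    { a<m = s≤s z≤n ; b<m = ≤-refl ; e≤m = ≤-refl
    ; ab = start {x = 0} {1} (λ ()) ; ae = start {y = 2} (λ ()) ; be = start (λ ()) }
  triple (suc k) = subst (Triple c (suc k)) (cong (2 +_) (+-comm (k * 4) 4)) (next (triple k))

-- Chains are indexed from the last vertex, twins from the first; `opposite` translates between
-- them.
opposite-anti-< : ∀ {k} {s t : Fin k} → s <ᶠ t → opposite t <ᶠ opposite s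
opposite-anti-< {s = s} {t} s<t =
  subst₂ _<_ (sym (Finₚ.opposite-prop t)) (sym (Finₚ.opposite-prop s))
    (∸-monoʳ-< (s<s s<t) (Finₚ.toℕ<n t))

opposite-step : ∀ {k} (s t : Fin k) → toℕ t ≡ suc (toℕ s) → toℕ (opposite s) ≡ suc (toℕ (opposite t))
opposite-step {suc k} s t t≡1+s = begin
  toℕ (opposite s)         ≡⟨ Finₚ.opposite-prop s ⟩
  k ∸ toℕ s                ≡⟨ +-∸-assoc 1 (subst (_≤ k) t≡1+s (s≤s⁻¹ (Finₚ.toℕ<n t))) ⟩
  suc (k ∸ suc (toℕ s))    ≡⟨ cong (λ u → suc (k ∸ u)) t≡1+s ⟨
  suc (k ∸ toℕ t)          ≡⟨ cong suc (Finₚ.opposite-prop t) ⟨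
  suc (toℕ (opposite t))   ∎
  where open ≡-Reasoning

toℕ-mod : ∀ {n} .{{_ : NonZero n}} {i} → i < n → toℕ (i mod n) ≡ i
toℕ-mod {n} {i} i<n = trans (Finₚ.toℕ-fromℕ< (m%n<n i n)) (m<n⇒m%n≡m i<n)

module _ {n : ℕ} .{{_ : NonZero n}} where

  -- Colours of pairs of numbers below n; the reduction modulo n only makes this total.
  onℕ : Coloring n 2 → ℕ → ℕ → Fin 2
  onℕ c i j = c (i mod n) (j mod n)

  -- An end bounds its whole side, so once both ends are below `n` the reduction modulo `n` changes
  -- no vertex.
  chain⇒twin : ∀ {c ℓ x y} → x < n → y < n → Chain (onℕ c) ℓ x y → Twin c (suc ℓ)
  chain⇒twin {c} {ℓ} x<n y<n ch = record
    { I       = λ s → left ch (opposite s) mod n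
    ; J       = λ s → right ch (opposite s) mod n
    ; I-inc   = increasing x<n ch
    ; J-inc   = increasing y<n (swap ch)
    ; disj    = λ s t eq → left≢right ch (opposite s) (opposite t)
                  (trans (sym (toℕ-mod (left<n x<n ch (opposite s))))
                    (trans (cong toℕ eq) (toℕ-mod (left<n y<n (swap ch) (opposite t)))))
    -- `onℕ` reduces vertices exactly as `I` and `J` do, so the colours agree without conversion.
    ; colours = λ s t t≡1+s → same-colours ch (opposite s) (opposite t) (opposite-step s t t≡1+s)
    }
    where
    left<n : ∀ {x y} → x < n → (ch : Chain (onℕ c) ℓ x y) → ∀ t → left ch t < n
    left<n x<n ch t = ≤-<-trans (left≤ ch t) x<n

    increasing : ∀ {x y} → x < n → (ch : Chain (onℕ c) ℓ x y) →
                 StrictInc (λ s → left ch (opposite s) mod n)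
    increasing x<n ch s t s<t =
      subst₂ _<_ (sym (toℕ-mod (left<n x<n ch (opposite s))))
                 (sym (toℕ-mod (left<n x<n ch (opposite t))))
        (left-decreasing ch (opposite-anti-< s<t))

emptyTwin : ∀ {n r} (c : Coloring n r) → Twin c 0
emptyTwin c = record
  { I = λ () ; J = λ () ; I-inc = λ () ; J-inc = λ () ; disj = λ () ; colours = λ () }

F₂-bound-1 : ∀ n → F₂-bound 1 n
F₂-bound-1 zero          c = 0 , emptyTwin c , z≤n
F₂-bound-1 (suc zero)    c = 0 , emptyTwin c , s≤s z≤n
-- After `m / 4` stages `a` and `b` are strictly below the bound, hence below `n`, whereas the third
-- vertex might equal `n`.
F₂-bound-1 (suc (suc m)) c = suc (m / 4) , chain⇒twin (<-≤-trans a<m ≤n) (<-≤-trans b<m ≤n) ab , bound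
  where
  open Triple (triple {onℕ c} (m / 4))

  ≤n : 2 + m / 4 * 4 ≤ 2 + m
  ≤n = +-monoʳ-≤ 2 (m/n*n≤m m 4)

  bound : 2 + m ≤ 4 * suc (m / 4) + 4
  bound = begin
    2 + m                      ≡⟨ cong (2 +_) (m≡m%n+[m/n]*n m 4) ⟩
    2 + (m % 4 + m / 4 * 4)    ≤⟨ +-monoʳ-≤ 2 (+-monoˡ-≤ (m / 4 * 4) (<⇒≤ (m%n<n m 4))) ⟩
    2 + (suc (m / 4) * 4)      ≡⟨ cong (2 +_) (*-comm (suc (m / 4)) 4) ⟩
    2 + 4 * suc (m / 4)        ≡⟨ +-comm 2 _ ⟩
    -- The actual loss is 2; it is rounded up to a multiple of 4 to have the form `4 * C`.
    4 * suc (m / 4) + 2        ≤⟨ +-monoʳ-≤ (4 * suc (m / 4)) (s≤s (s≤s z≤n)) ⟩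
    4 * suc (m / 4) + 4        ∎
    where open ≤-Reasoning

ascents : ∀ {n} → Permutation′ n → Coloring n 2
ascents π i j = if does ((π ⟨$⟩ʳ i) Finₚ.<? (π ⟨$⟩ʳ j)) then suc zero else zero

-- The remaining case, `P` true and `Q` false, would equate the two distinct colours.
dec-transport : ∀ {P Q : Set} (P? : Dec P) (Q? : Dec Q) →
                _≡_ {A = Fin 2} (if does P? then suc zero else zero) (if does Q? then suc zero else zero) →
                P → Q
dec-transport _       (yes q) _ _ = q
dec-transport (no ¬p) (no _)  _ p = contradiction p ¬p

twin⇒weakTwin : ∀ {n ℓ} (π : Permutation′ n) → Twin (ascents π) ℓ → WeakTwin π ℓ
twin⇒weakTwin π T = record
  { I = I ; J = J ; I-inc = I-inc ; J-inc = J-inc ; disj = disj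
  ; updown = λ s t t≡1+s → mk⇔
      (dec-transport (_ Finₚ.<? _) (_ Finₚ.<? _) (colours s t t≡1+s))
      (dec-transport (_ Finₚ.<? _) (_ Finₚ.<? _) (sym (colours s t t≡1+s)))
  }
  where open Twin T

theorem2 : Σ ℕ (λ C → ((n : ℕ) → 1 ≤ n → F₂-bound C n) × ((n : ℕ) → 1 ≤ n → Fweak-bound C n))
theorem2 = 1 , (λ n _ → F₂-bound-1 n) , λ n _ π →
  let ℓ , T , n≤ = F₂-bound-1 n (ascents π) in ℓ , twin⇒weakTwin π T , n≤
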